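{- In $NOM$, for all finite sequences $\Gamma,\Delta$ of formulas and all formulas $\phi,\psi,\chi$, the following rules are derivable: (i) from $\Gamma,\phi,\phi,\Delta\vdash\psi$ infer $\Gamma,\phi,\Delta\vdash\psi$; (ii) from $\Gamma,\phi,\Delta\vdash\psi$ infer $\Gamma,\phi,\phi,\Delta\vdash\psi$; (iii) from $\Gamma\vdash\phi$ and $\Gamma,\phi,\Delta\vdash\psi$ infer $\Gamma,\Delta\vdash\psi$; (iv) from $\Gamma\vdash\phi$ and $\Gamma,\Delta\vdash\psi$ infer $\Gamma,\phi,\Delta\vdash\psi$; (v) from $\Gamma,\phi,\psi\vdash\phi$, $\Gamma,\phi,\psi,\Delta\vdash\chi$ and $\Gamma,\psi,\phi\vdash\psi$ infer $\Gamma,\psi,\phi,\Delta\vdash\chi$; (vi) $\Gamma,\neg\phi,\phi,\Delta\vdash\psi$ is derivable; (vii) $\Gamma,\phi,\neg\phi,\Delta\vdash\psi$ is derivable; (viii) from $\Gamma,\neg\neg\phi,\Delta\vdash\psi$ infer $\Gamma,\phi,\Delta\vdash\psi$; (ix) from $\Gamma,\phi,\Delta\vdash\psi$ infer $\Gamma,\neg\neg\phi,\Delta\vdash\psi$; (x) from $\Gamma,\phi,\Delta\vdash\psi$ and $\Gamma,\neg\phi,\Delta\vdash\psi$ infer $\Gamma,\Delta\vdash\psi$.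
   Context: The propositional deductive system $NOM$: formulas are built from propositional letters using $\wedge$, $\rightarrow$, $\neg$. Sequents are $\phi_1,\ldots,\phi_n\vdash\psi$ ($n\ge0$) with antecedent a finite ordered sequence; commas denote concatenation. With $\Gamma$ a finite possibly empty sequence of formulas and $\phi,\psi,\chi$ formulas, the rules of $NOM$ are: (assumption) $\Gamma,\phi\vdash\phi$; (cut) $\Gamma\vdash\phi$, $\Gamma,\phi\vdash\psi$ $\Rightarrow$ $\Gamma\vdash\psi$; (paste) $\Gamma\vdash\phi$, $\Gamma\vdash\psi$ $\Rightarrow$ $\Gamma,\phi\vdash\psi$; (compatible exchange) $\Gamma,\phi,\psi\vdash\phi$, $\Gamma,\phi,\psi\vdash\chi$, $\Gamma,\psi,\phi\vdash\psi$ $\Rightarrow$ $\Gamma,\psi,\phi\vdash\chi$; ($\wedge$-intro) $\Gamma\vdash\phi$, $\Gamma\vdash\psi$ $\Rightarrow$ $\Gamma\vdash\phi\wedge\psi$; ($\wedge$-elim) $\Gamma\vdash\phi\wedge\psi$ $\Rightarrow$ $\Gamma\vdash\phi$ and $\Rightarrow$ $\Gamma\vdash\psi$; ($\rightarrow$-intro) $\Gamma,\phi\vdash\psi$ $\Rightarrow$ $\Gamma\vdash\phi\rightarrow\psi$; ($\rightarrow$-elim) $\Gamma\vdash\phi\rightarrow\psi$ $\Rightarrow$ $\Gamma,\phi\vdash\psi$; (excluded middle) $\Gamma,\phi\vdash\psi$, $\Gamma,\neg\phi\vdash\psi$ $\Rightarrow$ $\Gamma\vdash\psi$; (explosion) $\Gamma\vdash\neg\phi$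 $\Rightarrow$ $\Gamma,\phi\vdash\psi$. A rule schema is derivable if in every instance its conclusion can be derived from its premises using these rules. -}

module Defs where

open import Level using (Level)
open import Data.List.Base using (List; _∷ʳ_)
open import Data.List.Membership.Propositional using (_∈_)

infix  9 ¬_
infixr 8 _∧_
infixr 7 _⇒_
infix  4 _⊢_
infix  3 _⊩_

data Formula {a : Level} (Letter : Set a) : Set a where
  letter : Letter → Formula Letter
  _∧_    : Formula Letter → Formula Letter → Formula Letter
  _⇒_    : Formula Letter → Formula Letter → Formula Letter
  ¬_     : Formula Letter → Formula Letter

-- A sequent is only a piece of syntax; its derivability is expressed by _⊩_.
data Sequent {a : Level} (Letter : Set a) : Set a where
  _⊢_ : List (Formula Letter) → Formula Letter → Sequent Letter

-- P ⊩ s : the sequent s has a NOM derivation whose leaves may, besides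
-- instances of assumption, be sequents from the list P.  An instance of a rule
-- with premises P and conclusion s is thus derivable (and not merely
-- admissible) exactly when P ⊩ s.
data _⊩_ {a : Level} {Letter : Set a} (P : List (Sequent Letter)) :
         Sequent Letter → Set a where
  premise             : ∀ {s} → s ∈ P → P ⊩ s
  assumption          : ∀ {Γ φ} → P ⊩ Γ ∷ʳ φ ⊢ φ
  cut                 : ∀ {Γ φ ψ} → P ⊩ Γ ⊢ φ → P ⊩ Γ ∷ʳ φ ⊢ ψ → P ⊩ Γ ⊢ ψ
  paste               : ∀ {Γ φ ψ} → P ⊩ Γ ⊢ φ → P ⊩ Γ ⊢ ψ → P ⊩ Γ ∷ʳ φ ⊢ ψ
  compatible-exchange : ∀ {Γ φ ψ χ} →
                        P ⊩ Γ ∷ʳ φ ∷ʳ ψ ⊢ φ →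
                        P ⊩ Γ ∷ʳ φ ∷ʳ ψ ⊢ χ →
                        P ⊩ Γ ∷ʳ ψ ∷ʳ φ ⊢ ψ →
                        P ⊩ Γ ∷ʳ ψ ∷ʳ φ ⊢ χ
  ∧-intro             : ∀ {Γ φ ψ} → P ⊩ Γ ⊢ φ → P ⊩ Γ ⊢ ψ → P ⊩ Γ ⊢ φ ∧ ψ
  ∧-elimˡ             : ∀ {Γ φ ψ} → P ⊩ Γ ⊢ φ ∧ ψ → P ⊩ Γ ⊢ φ
  ∧-elimʳ             : ∀ {Γ φ ψ} → P ⊩ Γ ⊢ φ ∧ ψ → P ⊩ Γ ⊢ ψ
  ⇒-intro             : ∀ {Γ φ ψ} → P ⊩ Γ ∷ʳ φ ⊢ ψ → P ⊩ Γ ⊢ φ ⇒ ψ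
  ⇒-elim              : ∀ {Γ φ ψ} → P ⊩ Γ ⊢ φ ⇒ ψ → P ⊩ Γ ∷ʳ φ ⊢ ψ
  excluded-middle     : ∀ {Γ φ ψ} → P ⊩ Γ ∷ʳ φ ⊢ ψ → P ⊩ Γ ∷ʳ ¬ φ ⊢ ψ → P ⊩ Γ ⊢ ψ
  explosion           : ∀ {Γ φ ψ} → P ⊩ Γ ⊢ ¬ φ → P ⊩ Γ ∷ʳ φ ⊢ ψ

{-# OPTIONS --safe #-}
-- The rules ⇒-intro and ⇒-elim move the formulas of Δ across the turnstile, so
-- every rule reduces to the case where Δ is empty.  The only rules that are then
-- not immediate are those involving φ, ¬ φ and ¬ ¬ φ; there the key observation
-- is that Γ, ¬ ¬ φ ⊢ φ follows from explosion by excluded middle on φ, after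
-- which excluded middle on ¬ φ shows that Γ, φ, ¬ φ is inconsistent.
module Submission where

open import Defs
open import Level using (Level)
open import Data.List.Base using (List; []; _∷_; _++_; _∷ʳ_; foldr)
open import Data.List.Properties using (++-identityʳ; ∷ʳ-++)
open import Data.List.Relation.Unary.Any using (here; there)
open import Data.Product.Base using (_×_; _,_)
open import Relation.Binary.PropositionalEquality using (refl; sym; subst)

private
  variable
    a : Level
    Letter : Set a
    P : List (Sequent Letter)
    φ ψ χ : Formula Letter

infixr 7 _⇛_

_⇛_ : {Letter : Set a} → List (Formula Letter) → Formula Letter → Formula Letter
Δ ⇛ ψ = foldr _⇒_ ψ Δ

⇛-intro : ∀ Γ Δ → P ⊩ Γ ++ Δ ⊢ ψ → P ⊩ Γ ⊢ Δ ⇛ ψ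
⇛-intro {P = P} {ψ = ψ} Γ [] d =
  subst (λ Θ → P ⊩ Θ ⊢ ψ) (++-identityʳ Γ) d
⇛-intro {P = P} {ψ = ψ} Γ (φ ∷ Δ) d =
  ⇒-intro (⇛-intro (Γ ∷ʳ φ) Δ (subst (λ Θ → P ⊩ Θ ⊢ ψ) (sym (∷ʳ-++ Γ φ Δ)) d))

⇛-elim : ∀ Γ Δ → P ⊩ Γ ⊢ Δ ⇛ ψ → P ⊩ Γ ++ Δ ⊢ ψ
⇛-elim {P = P} {ψ = ψ} Γ [] d =
  subst (λ Θ → P ⊩ Θ ⊢ ψ) (sym (++-identityʳ Γ)) d
⇛-elim {P = P} {ψ = ψ} Γ (φ ∷ Δ) d =
  subst (λ Θ → P ⊩ Θ ⊢ ψ) (∷ʳ-++ Γ φ Δ) (⇛-elim (Γ ∷ʳ φ) Δ (⇒-elim d))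

¬¬-elim : ∀ Γ → P ⊩ Γ ∷ʳ ¬ ¬ φ ⊢ φ
¬¬-elim {φ = φ} Γ = excluded-middle (assumption {Γ = Γ ∷ʳ ¬ ¬ φ}) (explosion (assumption {Γ = Γ}))

¬-then-self : ∀ Γ → P ⊩ Γ ∷ʳ ¬ φ ∷ʳ φ ⊢ ψ
¬-then-self Γ = explosion (assumption {Γ = Γ})

-- Excluded middle only adds a formula at the end of the antecedent, so `φ` and `¬ φ` are first
-- moved across the turnstile; the split on `¬ φ` then takes place directly after `Γ`.
self-then-¬ : ∀ Γ → P ⊩ Γ ∷ʳ φ ∷ʳ ¬ φ ⊢ ψ
self-then-¬ {φ = φ} {ψ = ψ} Γ = ⇒-elim (⇒-elim (excluded-middle {φ = ¬ φ}
  -- `Γ, ¬ φ, φ` already explodes, and `paste` appends the second `¬ φ`.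
  (⇒-intro (⇒-intro (paste (¬-then-self Γ) (¬-then-self Γ))))
  -- `¬ ¬ φ` alone yields `φ` and, by explosion, `¬ φ ⇒ ψ`; `paste` appends `φ` and keeps the
  -- implication.
  (⇒-intro (paste (¬¬-elim Γ) (⇒-intro (¬-then-self Γ))))))

¬¬-intro : ∀ Γ → P ⊩ Γ ∷ʳ φ ⊢ ¬ ¬ φ
¬¬-intro {φ = φ} Γ = excluded-middle {φ = ¬ φ} (self-then-¬ Γ) (assumption {Γ = Γ ∷ʳ φ})

-- `paste` carries `χ` from `φ` to the pair `φ, ψ`; interderivability supplies both compatibility
-- premises for the exchange, and `cut` then drops the trailing `φ`. This serves to trade `φ` for
-- `¬ ¬ φ` in either direction.
interderivable-antecedents : ∀ Γ → P ⊩ Γ ∷ʳ φ ⊢ ψ → P ⊩ Γ ∷ʳ ψ ⊢ φ →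
                             P ⊩ Γ ∷ʳ φ ⊢ χ → P ⊩ Γ ∷ʳ ψ ⊢ χ
interderivable-antecedents Γ φ⊢ψ ψ⊢φ φ⊢χ = cut ψ⊢φ
  (compatible-exchange {Γ = Γ}
    (paste φ⊢ψ (assumption {Γ = Γ})) (paste φ⊢ψ φ⊢χ) (paste ψ⊢φ (assumption {Γ = Γ})))

theorem2p6 : {a : Level} {Letter : Set a}
    (Γ Δ : List (Formula Letter)) (φ ψ χ : Formula Letter) →
    ((Γ ++ φ ∷ φ ∷ Δ ⊢ ψ) ∷ [] ⊩ Γ ++ φ ∷ Δ ⊢ ψ)
    × ((Γ ++ φ ∷ Δ ⊢ ψ) ∷ [] ⊩ Γ ++ φ ∷ φ ∷ Δ ⊢ ψ)
    × ((Γ ⊢ φ) ∷ (Γ ++ φ ∷ Δ ⊢ ψ) ∷ [] ⊩ Γ ++ Δ ⊢ ψ)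
    × ((Γ ⊢ φ) ∷ (Γ ++ Δ ⊢ ψ) ∷ [] ⊩ Γ ++ φ ∷ Δ ⊢ ψ)
    × ((Γ ++ φ ∷ ψ ∷ [] ⊢ φ) ∷ (Γ ++ φ ∷ ψ ∷ Δ ⊢ χ) ∷ (Γ ++ ψ ∷ φ ∷ [] ⊢ ψ) ∷ []
    ⊩ Γ ++ ψ ∷ φ ∷ Δ ⊢ χ)
    × ([] ⊩ Γ ++ ¬ φ ∷ φ ∷ Δ ⊢ ψ)
    × ([] ⊩ Γ ++ φ ∷ ¬ φ ∷ Δ ⊢ ψ)
    × ((Γ ++ ¬ ¬ φ ∷ Δ ⊢ ψ) ∷ [] ⊩ Γ ++ φ ∷ Δ ⊢ ψ)
    × ((Γ ++ φ ∷ Δ ⊢ ψ) ∷ [] ⊩ Γ ++ ¬ ¬ φ ∷ Δ ⊢ ψ)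
    × ((Γ ++ φ ∷ Δ ⊢ ψ) ∷ (Γ ++ ¬ φ ∷ Δ ⊢ ψ) ∷ [] ⊩ Γ ++ Δ ⊢ ψ)
theorem2p6 Γ Δ φ ψ χ =
    elim₁ (cut (assumption {Γ = Γ}) (intro₂ Δ first))
  , elim₂ (paste (assumption {Γ = Γ}) (intro₁ first))
  , ⇛-elim Γ Δ (cut first (intro₁ second))
  , elim₁ (paste first (⇛-intro Γ Δ second))
  -- Only the middle premise has the tail `Δ`; the two compatibility premises end with the exchanged
  -- pair, hence the empty tail for them.
  , elim₂ (compatible-exchange {Γ = Γ} (intro₂ [] first) (intro₂ Δ second) (intro₂ [] third))
  , elim₂ (¬-then-self Γ)
  , elim₂ (self-then-¬ Γ)
  , elim₁ (interderivable-antecedents Γ (¬¬-elim Γ) (¬¬-intro Γ) (intro₁ first))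
  , elim₁ (interderivable-antecedents Γ (¬¬-intro Γ) (¬¬-elim Γ) (intro₁ first))
  , ⇛-elim Γ Δ (excluded-middle (intro₁ first) (intro₁ second))
  where
  first : ∀ {s ss} → s ∷ ss ⊩ s
  first = premise (here refl)

  second : ∀ {s t ss} → s ∷ t ∷ ss ⊩ t
  second = premise (there (here refl))

  third : ∀ {s t u ss} → s ∷ t ∷ u ∷ ss ⊩ u
  third = premise (there (there (here refl)))

  -- Only `Δ` stays on the right: `α` must end the antecedent, where the rules act.
  intro₁ : ∀ {Q α γ} → Q ⊩ Γ ++ α ∷ Δ ⊢ γ → Q ⊩ Γ ∷ʳ α ⊢ Δ ⇛ γ
  intro₁ {α = α} d = ⇒-elim (⇛-intro Γ (α ∷ Δ) d)

  intro₂ : ∀ {Q α β γ} Θ → Q ⊩ Γ ++ α ∷ β ∷ Θ ⊢ γ → Q ⊩ Γ ∷ʳ α ∷ʳ β ⊢ Θ ⇛ γ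
  intro₂ {α = α} {β} Θ d = ⇒-elim (⇒-elim (⇛-intro Γ (α ∷ β ∷ Θ) d))

  elim₁ : ∀ {Q α γ} → Q ⊩ Γ ∷ʳ α ⊢ Δ ⇛ γ → Q ⊩ Γ ++ α ∷ Δ ⊢ γ
  elim₁ {α = α} d = ⇛-elim Γ (α ∷ Δ) (⇒-intro d)

  elim₂ : ∀ {Q α β γ} → Q ⊩ Γ ∷ʳ α ∷ʳ β ⊢ Δ ⇛ γ → Q ⊩ Γ ++ α ∷ β ∷ Δ ⊢ γ
  elim₂ {α = α} {β} d = ⇛-elim Γ (α ∷ β ∷ Δ) (⇒-intro (⇒-intro d))
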